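{- Let $k$ be a positive integer. As formal power series, $$B_k(x)=\frac{E_k(x)}{k+1-k\cdot E_k(x)}.$$
   Context: All paths are lattice paths in $\mathbb{Z}^2$ composed only of unit steps to the right $(1,0)$ and up $(0,1)$. For $n\ge 0$, $b_k(n)=\binom{kn+n}{n}$ is the number of bridges of size $n$, i.e. of paths from $(0,0)$ to $(kn,n)$, and $e_k(n)$ is the number of excursions of size $n$, i.e. of paths from $(0,0)$ to $(kn,n)$ staying weakly above the line $y=x/k$; these are the $k$-Catalan numbers $e_k(n)=\frac{1}{kn+1}\binom{kn+n}{n}$. The ordinary generating functions are $$B_k(x)=\sum_{n\ge 0} b_k(n)x^n=\sum_{n\ge0}\binom{kn+n}{n}x^n,\qquad E_k(x)=\sum_{n\ge 0} e_k(n)x^n=\sum_{n\ge0}\frac{1}{kn+1}\binom{kn+n}{n}x^n.$$ -}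

module Defs where

open import Data.Integer as ℤ using (+_)
import Data.Integer.Properties as ℤ
open import Data.List using (List; []; _∷_; [_]; _++_; map; filter; length)
open import Data.List.Relation.Unary.All using (All; all?)
open import Data.Nat as ℕ using (ℕ; zero; suc)
import Data.Nat.Properties as ℕ
open import Data.Product using (_×_; _,_)
open import Data.Product.Properties using (≡-dec)
open import Data.Rational as ℚ using (ℚ; 0ℚ; 1ℚ; NonZero)
import Data.Rational.Properties as ℚ
import Data.Rational.Unnormalised as ℚᵘ
import Data.Rational.Unnormalised.Properties as ℚᵘ
open import Relation.Binary.PropositionalEquality
  using (_≡_; _≗_; refl; sym; trans; cong; cong₂; subst; module ≡-Reasoning)
open import Relation.Nullary.Decidable using (_×-dec_)
open import Relation.Unary using (Decidable)

-- Paths start at the origin and never step left or down, so only points of ℤ²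
-- with natural coordinates occur.

Point : Set
Point = ℕ × ℕ

origin : Point
origin = 0 , 0

data Step : Set where
  right up : Step

Path : Set
Path = List Step

move : Step → Point → Point
move right (x , y) = suc x , y
move up    (x , y) = x , suc y

endpoint : Point → Path → Point
endpoint P []      = P
endpoint P (s ∷ w) = endpoint (move s P) w

vertices : Point → Path → List Point
vertices P []      = [ P ]
vertices P (s ∷ w) = P ∷ vertices (move s P) w

-- y ≥ x / k for k > 0, with the denominator cleared.
WeaklyAbove : ℕ → Point → Set
WeaklyAbove k (x , y) = x ℕ.≤ k ℕ.* y

IsBridge : ℕ → ℕ → Path → Set
IsBridge k n w = endpoint origin w ≡ (k ℕ.* n , n)

-- Segments between consecutive vertices need no separate condition: the region
-- weakly above a line is convex.
IsExcursion : ℕ → ℕ → Path → Set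
IsExcursion k n w = IsBridge k n w × All (WeaklyAbove k) (vertices origin w)

isBridge? : ∀ k n → Decidable (IsBridge k n)
isBridge? k n w = ≡-dec ℕ._≟_ ℕ._≟_ (endpoint origin w) (k ℕ.* n , n)

isExcursion? : ∀ k n → Decidable (IsExcursion k n)
isExcursion? k n w =
  isBridge? k n w ×-dec all? (λ (x , y) → x ℕ.≤? k ℕ.* y) (vertices origin w)

-- All paths with ℓ steps, each listed exactly once.
paths : ℕ → List Path
paths zero    = [ [] ]
paths (suc ℓ) = map (right ∷_) (paths ℓ) ++ map (up ∷_) (paths ℓ)

-- A path from the origin to (k n , n) necessarily has k n + n steps.

b : ℕ → ℕ → ℕ
b k n = length (filter (isBridge? k n) (paths (k ℕ.* n ℕ.+ n)))

e : ℕ → ℕ → ℕ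
e k n = length (filter (isExcursion? k n) (paths (k ℕ.* n ℕ.+ n)))

-- Formal power series over ℚ, as coefficient sequences; they are compared
-- coefficientwise, with _≗_.

Series : Set
Series = ℕ → ℚ

tail : Series → Series
tail F n = F (suc n)

const : ℚ → Series
const c zero    = c
const c (suc _) = 0ℚ

infixl 6 _⊖_
infixl 7 _⊛_ _⊘_
infixr 8 _·_

_⊖_ : Series → Series → Series
(F ⊖ G) n = F n ℚ.- G n

_·_ : ℚ → Series → Series
(c · F) n = c ℚ.* F n

-- The Cauchy product: (F ⊛ G) n = F 0 * G n + F 1 * G (n - 1) + ⋯ + F n * G 0.
_⊛_ : Series → Series → Series
(F ⊛ G) zero    = F 0 ℚ.* G 0
(F ⊛ G) (suc n) = F 0 ℚ.* G (suc n) ℚ.+ (tail F ⊛ G) n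

-- Long division.  With c = F 0 / G 0,
--   F / G = c + x · ((tail F - c · tail G) / G).
_⊘_ : (F G : Series) .{{_ : NonZero (G 0)}} → Series
(F ⊘ G) zero    = F 0 ℚ.÷ G 0
(F ⊘ G) (suc n) = ((tail F ⊖ (F 0 ℚ.÷ G 0) · tail G) ⊘ G) n

⊘-⊛-cancel : ∀ F G .{{_ : NonZero (G 0)}} → (F ⊘ G) ⊛ G ≗ F
⊘-⊛-cancel F G zero = begin
  F 0 ℚ.* ℚ.1/ G 0 ℚ.* G 0    ≡⟨ ℚ.*-assoc (F 0) (ℚ.1/ G 0) (G 0) ⟩
  F 0 ℚ.* (ℚ.1/ G 0 ℚ.* G 0)  ≡⟨ cong (F 0 ℚ.*_) (ℚ.*-inverseˡ (G 0)) ⟩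
  F 0 ℚ.* 1ℚ                  ≡⟨ ℚ.*-identityʳ (F 0) ⟩
  F 0                         ∎
  where open ≡-Reasoning
⊘-⊛-cancel F G (suc n) = begin
  t ℚ.+ ((tail F ⊖ c · tail G) ⊘ G ⊛ G) n
    ≡⟨ cong (t ℚ.+_) (⊘-⊛-cancel (tail F ⊖ c · tail G) G n) ⟩
  t ℚ.+ (F (suc n) ℚ.- t)      ≡⟨ ℚ.+-comm t (F (suc n) ℚ.- t) ⟩
  F (suc n) ℚ.- t ℚ.+ t        ≡⟨ ℚ.+-assoc (F (suc n)) (ℚ.- t) t ⟩
  F (suc n) ℚ.+ (ℚ.- t ℚ.+ t)  ≡⟨ cong (F (suc n) ℚ.+_) (ℚ.+-inverseˡ t) ⟩
  F (suc n) ℚ.+ 0ℚ             ≡⟨ ℚ.+-identityʳ (F (suc n)) ⟩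
  F (suc n)                    ∎
  where
  open ≡-Reasoning
  c = F 0 ℚ.÷ G 0
  t = c ℚ.* G (suc n)

fromℕ : ℕ → ℚ
fromℕ n = + n ℚ./ 1

B : ℕ → Series
B k n = fromℕ (b k n)

E : ℕ → Series
E k n = fromℕ (e k n)

-- The series k + 1 - k · E k; its constant coefficient is 1.
denominator : ℕ → Series
denominator k = const (fromℕ (k ℕ.+ 1)) ⊖ fromℕ k · E k

e-zero : ∀ k → e k 0 ≡ 1
e-zero k rewrite ℕ.*-zeroʳ k = refl

fromℕ-+ : ∀ m n → fromℕ (m ℕ.+ n) ≡ fromℕ m ℚ.+ fromℕ n
fromℕ-+ m n = ℚ.toℚᵘ-injective (begin
  ℚ.toℚᵘ (fromℕ (m ℕ.+ n))                 ≈⟨ ℚ.toℚᵘ-fromℚᵘ (i (m ℕ.+ n)) ⟩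
  i (m ℕ.+ n)                              ≈⟨ ℚᵘ.*≡* (cong (ℤ._* + 1) (sym
    (cong₂ ℤ._+_ (ℤ.*-identityʳ (+ m)) (ℤ.*-identityʳ (+ n))))) ⟩
  i m ℚᵘ.+ i n                             ≈⟨ ℚᵘ.+-cong (ℚ.toℚᵘ-fromℚᵘ (i m)) (ℚ.toℚᵘ-fromℚᵘ (i n)) ⟨
  ℚ.toℚᵘ (fromℕ m) ℚᵘ.+ ℚ.toℚᵘ (fromℕ n)   ≈⟨ ℚ.toℚᵘ-homo-+ (fromℕ m) (fromℕ n) ⟨
  ℚ.toℚᵘ (fromℕ m ℚ.+ fromℕ n)             ∎)
  where
  open ℚᵘ.≃-Reasoning
  i : ℕ → ℚᵘ.ℚᵘ
  i n = ℚᵘ.mkℚᵘ (+ n) 0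

denominator-zero : ∀ k → denominator k 0 ≡ 1ℚ
denominator-zero k = begin
  fromℕ (k ℕ.+ 1) ℚ.- q ℚ.* fromℕ (e k 0)
    ≡⟨ cong (λ m → fromℕ (k ℕ.+ 1) ℚ.- q ℚ.* fromℕ m) (e-zero k) ⟩
  fromℕ (k ℕ.+ 1) ℚ.- q ℚ.* 1ℚ  ≡⟨ cong₂ ℚ._-_ (trans (fromℕ-+ k 1) (ℚ.+-comm q 1ℚ)) (ℚ.*-identityʳ q) ⟩
  1ℚ ℚ.+ q ℚ.- q                ≡⟨ ℚ.+-assoc 1ℚ q (ℚ.- q) ⟩
  1ℚ ℚ.+ (q ℚ.- q)              ≡⟨ cong (1ℚ ℚ.+_) (ℚ.+-inverseʳ q) ⟩
  1ℚ                            ∎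
  where
  open ≡-Reasoning
  q = fromℕ k

denominator-nonZero : ∀ k → NonZero (denominator k 0)
denominator-nonZero k = subst NonZero (sym (denominator-zero k)) _

{-# OPTIONS --safe #-}

-- Write B = B k and E = E k.  Follow a path through its height k y - x, which an
-- up step raises by k and a right step lowers by 1.  Cutting a path from height
-- 0 to height -1 where it first reaches -1 leaves an excursion, a right step
-- and a bridge, whence
--   [xⁿ] B E = C(kn + n + 1, n).
-- The ballot identity
--   e k n + k C(kn + n + 1, n) = (k + 1) C(kn + n, n)
-- then reads E + k B E = (k + 1) B, that is, B (k + 1 - k E) = E.  Both
-- identities generalise to paths starting at any height, where decomposing by
-- the first step reduces them to Pascal's rule.

module Submission where

open import Defs
open import Data.Nat using (ℕ; zero; suc; NonZero; _+_; _*_; _≤_; _<_; _≤?_; _≟_)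
open import Data.Nat.Combinatorics
  using (_C_; nCn≡1; k>n⇒nCk≡0; nCk+nC[k+1]≡[n+1]C[k+1])
open import Data.Nat.Properties
open import Data.Nat.Tactic.RingSolver using (solve-∀)
open import Data.Bool using (true; false)
open import Data.List using ([]; _∷_; _++_; map; filter; length)
open import Data.List.Properties
  using (length-++; filter-++; filter-≐; filter-none; filter-accept)
open import Data.List.Relation.Unary.All as All using (All; []; _∷_; all?; universal)
open import Data.Product using (_×_; _,_; proj₁; proj₂)
open import Data.Product.Properties using (≡-dec)
open import Data.Rational as ℚ using (0ℚ; 1ℚ)
import Data.Rational.Properties as ℚ
open import Data.Rational.Solver using (module +-*-Solver)
open import Function using (_∘_)
open import Relation.Binary.PropositionalEquality
  using (_≡_; _≗_; refl; sym; trans; cong; cong₂; subst; module ≡-Reasoning)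
open import Relation.Nullary using (¬_; does)
open import Relation.Nullary.Decidable using (_×-dec_)
open import Relation.Unary using (Decidable; _≐_)

private variable
  P Q : Path → Set

-- Counting paths

numberOf : Decidable P → ℕ → ℕ
numberOf P? ℓ = length (filter P? (paths ℓ))

length-filter-map : {A A′ : Set} {R : A′ → Set} (R? : Decidable R) (f : A → A′) →
  ∀ xs → length (filter R? (map f xs)) ≡ length (filter (R? ∘ f) xs)
length-filter-map R? f []       = refl
length-filter-map R? f (x ∷ xs) with does (R? (f x))
... | true  = cong suc (length-filter-map R? f xs)
... | false = length-filter-map R? f xs

numberOf-suc : (P? : Decidable P) → ∀ ℓ →
  numberOf P? (suc ℓ) ≡ numberOf (P? ∘ (right ∷_)) ℓ + numberOf (P? ∘ (up ∷_)) ℓ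
numberOf-suc P? ℓ = begin
  length (filter P? (rs ++ us))
    ≡⟨ cong length (filter-++ P? rs us) ⟩
  length (filter P? rs ++ filter P? us)
    ≡⟨ length-++ (filter P? rs) ⟩
  length (filter P? rs) + length (filter P? us)
    ≡⟨ cong₂ _+_ (length-filter-map P? (right ∷_) (paths ℓ)) (length-filter-map P? (up ∷_) (paths ℓ)) ⟩
  numberOf (P? ∘ (right ∷_)) ℓ + numberOf (P? ∘ (up ∷_)) ℓ ∎
  where
  open ≡-Reasoning
  rs = map (right ∷_) (paths ℓ)
  us = map (up ∷_) (paths ℓ)

numberOf-≐ : (P? : Decidable P) (Q? : Decidable Q) → P ≐ Q →
  ∀ ℓ → numberOf P? ℓ ≡ numberOf Q? ℓ
numberOf-≐ P? Q? P≐Q ℓ = cong length (filter-≐ P? Q? P≐Q (paths ℓ))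

numberOf-none : (P? : Decidable P) → (∀ w → ¬ P w) → ∀ ℓ → numberOf P? ℓ ≡ 0
numberOf-none P? ¬P ℓ = cong length (filter-none P? (universal ¬P (paths ℓ)))

numberOf-[] : (P? : Decidable P) → P [] → numberOf P? 0 ≡ 1
numberOf-[] P? p = cong length (filter-accept P? p)

endpoint-≥₁ : ∀ x y w → x ≤ proj₁ (endpoint (x , y) w)
endpoint-≥₁ x y []          = ≤-refl
endpoint-≥₁ x y (right ∷ w) = <⇒≤ (endpoint-≥₁ (suc x) y w)
endpoint-≥₁ x y (up ∷ w)    = endpoint-≥₁ x (suc y) w

endpoint-≥₂ : ∀ x y w → y ≤ proj₂ (endpoint (x , y) w)
endpoint-≥₂ x y []          = ≤-refl
endpoint-≥₂ x y (right ∷ w) = endpoint-≥₂ (suc x) y w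
endpoint-≥₂ x y (up ∷ w)    = <⇒≤ (endpoint-≥₂ x (suc y) w)

endsAt? : (A Z : Point) → Decidable (λ w → endpoint A w ≡ Z)
endsAt? A Z w = ≡-dec _≟_ _≟_ (endpoint A w) Z

past₁ : ∀ {x y X Y} → X < x → ∀ w → ¬ endpoint (x , y) w ≡ (X , Y)
past₁ {x} {y} X<x w eq = <⇒≱ X<x (subst (x ≤_) (cong proj₁ eq) (endpoint-≥₁ x y w))

past₂ : ∀ {x y X Y} → Y < y → ∀ w → ¬ endpoint (x , y) w ≡ (X , Y)
past₂ {x} {y} Y<y w eq = <⇒≱ Y<y (subst (y ≤_) (cong proj₂ eq) (endpoint-≥₂ x y w))

-- Splitting by the first step gives Pascal's rule; once only one kind of step remains to be taken,
-- the other kind overshoots the target and contributes nothing. Writing the target as an offset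
-- from the start lets the start move in the induction.
numberOf-endsAt : ∀ ℓ x y r u → ℓ ≡ r + u →
  numberOf (endsAt? (x , y) (x + r , y + u)) ℓ ≡ ℓ C u
numberOf-endsAt zero x y zero zero refl =
  numberOf-[] (endsAt? (x , y) (x + 0 , y + 0)) (sym (cong₂ _,_ (+-identityʳ x) (+-identityʳ y)))
numberOf-endsAt (suc ℓ) x y zero (suc .ℓ) refl = begin
  numberOf (endsAt? (x , y) Z) (suc ℓ)
    ≡⟨ numberOf-suc (endsAt? (x , y) Z) ℓ ⟩
  numberOf (endsAt? (suc x , y) Z) ℓ + numberOf (endsAt? (x , suc y) Z) ℓ
    ≡⟨ cong₂ _+_ (numberOf-none (endsAt? (suc x , y) Z) (past₁ (≤-reflexive (cong suc (+-identityʳ x)))) ℓ)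
                 (cong (λ v → numberOf (endsAt? (x , suc y) (x + 0 , v)) ℓ) (+-suc y ℓ)) ⟩
  numberOf (endsAt? (x , suc y) (x + 0 , suc y + ℓ)) ℓ
    ≡⟨ numberOf-endsAt ℓ x (suc y) zero ℓ refl ⟩
  ℓ C ℓ          ≡⟨ nCn≡1 ℓ ⟩
  1              ≡⟨ nCn≡1 (suc ℓ) ⟨
  suc ℓ C suc ℓ  ∎
  where
  open ≡-Reasoning
  Z = (x + 0 , y + suc ℓ)
numberOf-endsAt (suc ℓ) x y (suc r) zero eq = begin
  numberOf (endsAt? (x , y) Z) (suc ℓ)
    ≡⟨ numberOf-suc (endsAt? (x , y) Z) ℓ ⟩
  numberOf (endsAt? (suc x , y) Z) ℓ + numberOf (endsAt? (x , suc y) Z) ℓ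
    ≡⟨ cong₂ _+_ (cong (λ v → numberOf (endsAt? (suc x , y) (v , y + 0)) ℓ) (+-suc x r))
                 (numberOf-none (endsAt? (x , suc y) Z) (past₂ (≤-reflexive (cong suc (+-identityʳ y)))) ℓ) ⟩
  numberOf (endsAt? (suc x , y) (suc x + r , y + 0)) ℓ + 0
    ≡⟨ cong (_+ 0) (numberOf-endsAt ℓ (suc x) y r zero (suc-injective eq)) ⟩
  1  ∎
  where
  open ≡-Reasoning
  Z = (x + suc r , y + 0)
numberOf-endsAt (suc ℓ) x y (suc r) (suc u) eq = begin
  numberOf (endsAt? (x , y) Z) (suc ℓ)
    ≡⟨ numberOf-suc (endsAt? (x , y) Z) ℓ ⟩
  numberOf (endsAt? (suc x , y) Z) ℓ + numberOf (endsAt? (x , suc y) Z) ℓ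
    ≡⟨ cong₂ _+_ (cong (λ v → numberOf (endsAt? (suc x , y) (v , y + suc u)) ℓ) (+-suc x r))
                 (cong (λ v → numberOf (endsAt? (x , suc y) (x + suc r , v)) ℓ) (+-suc y u)) ⟩
  numberOf (endsAt? (suc x , y) (suc x + r , y + suc u)) ℓ
    + numberOf (endsAt? (x , suc y) (x + suc r , suc y + u)) ℓ
    ≡⟨ cong₂ _+_ (numberOf-endsAt ℓ (suc x) y r (suc u) (suc-injective eq))
                 (numberOf-endsAt ℓ x (suc y) (suc r) u (trans (suc-injective eq) (+-suc r u))) ⟩
  ℓ C suc u + ℓ C u  ≡⟨ +-comm (ℓ C suc u) (ℓ C u) ⟩
  ℓ C u + ℓ C suc u  ≡⟨ nCk+nC[k+1]≡[n+1]C[k+1] ℓ u ⟩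
  suc ℓ C suc u      ∎
  where
  open ≡-Reasoning
  Z = (x + suc r , y + suc u)

b≡C : ∀ k n → b k n ≡ (k * n + n) C n
b≡C k n = numberOf-endsAt (k * n + n) 0 0 (k * n) n refl

-- The number of paths with n up steps that start at height j and are at height
-- 0 exactly when they end.
firstPassage : ℕ → ℕ → ℕ → ℕ
firstPassage k zero    j       = 1
firstPassage k (suc n) zero    = 0
firstPassage k (suc n) (suc j) = firstPassage k (suc n) j + firstPassage k n (suc (k + j))

-- A path at height `h` with `u` up steps left has `k * u + h` right steps left. This and `size-up`
-- say that either step shortens the remaining length by one.
size-right : ∀ k u h → k * u + suc h + u ≡ suc (k * u + h + u)
size-right = solve-∀

size-up : ∀ k u h → k * suc u + h + suc u ≡ suc (k * u + (k + h) + u)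
size-up = solve-∀

-- Excursions counted as first passages

module _ (k n : ℕ) where

  -- The starting point is arbitrary because removing the first step moves it.
  Excursion : Point → Path → Set
  Excursion A w = endpoint A w ≡ (k * n , n) × All (WeaklyAbove k) (vertices A w)

  excursion? : ∀ A → Decidable (Excursion A)
  excursion? A w = endsAt? A (k * n , n) w ×-dec all? (λ (x , y) → x ≤? k * y) (vertices A w)

  start-above : ∀ A w → All (WeaklyAbove k) (vertices A w) → WeaklyAbove k A
  start-above A []      (a ∷ _) = a
  start-above A (s ∷ w) (a ∷ _) = a

  -- The bound supplies the condition at the starting vertex, so the vertices after the first step
  -- carry all that remains to be required.
  excursions-suc : ∀ ℓ x y → x ≤ k * y →
    numberOf (excursion? (x , y)) (suc ℓ)
      ≡ numberOf (excursion? (suc x , y)) ℓ + numberOf (excursion? (x , suc y)) ℓ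
  excursions-suc ℓ x y above =
    trans (numberOf-suc (excursion? (x , y)) ℓ) (cong₂ _+_ (step right) (step up))
    where
    step : ∀ s → numberOf (excursion? (x , y) ∘ (s ∷_)) ℓ ≡ numberOf (excursion? (move s (x , y))) ℓ
    step s = numberOf-≐ (excursion? (x , y) ∘ (s ∷_)) (excursion? (move s (x , y)))
      ((λ (end , all) → end , All.tail all) , (λ (end , all) → end , above ∷ all)) ℓ

  overshoot : ∀ ℓ x y → n < y → numberOf (excursion? (x , y)) ℓ ≡ 0
  overshoot ℓ x y n<y =
    numberOf-none (excursion? (x , y)) (λ w (end , _) → past₂ n<y w end) ℓ

  below : ∀ ℓ x y → k * y < x → numberOf (excursion? (x , y)) ℓ ≡ 0
  below ℓ x y ky<x = numberOf-none (excursion? (x , y))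
    (λ w (_ , all) → <⇒≱ ky<x (start-above (x , y) w all)) ℓ

  -- Appending a right step to a path that stays at height at least 0 and ends at 0 makes it a first
  -- passage to -1; raising all heights by 1 gives the start `suc h`. The equations state, without
  -- subtraction, that `h` is the present height, `u` the number of up steps left and `ℓ` the
  -- remaining length.
  numberOf-excursions : ∀ ℓ x y h u → x + h ≡ k * y → y + u ≡ n → ℓ ≡ k * u + h + u →
    numberOf (excursion? (x , y)) ℓ ≡ firstPassage k u (suc h)

  excursions-up : ∀ ℓ x y h u → x + h ≡ k * y → y + suc u ≡ n → suc ℓ ≡ k * suc u + h + suc u →
    numberOf (excursion? (x , suc y)) ℓ ≡ firstPassage k u (suc (k + h))
  excursions-up ℓ x y h u height ups size = numberOf-excursions ℓ x (suc y) (k + h) u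
    (trans (swap x k h) (trans (cong (k +_) height) (sym (*-suc k y))))
    (trans (sym (+-suc y u)) ups)
    (suc-injective (trans size (size-up k u h)))
    where
    swap : ∀ x k h → x + (k + h) ≡ k + (x + h)
    swap = solve-∀

  numberOf-excursions zero x y zero zero height ups size =
    numberOf-[] (excursion? (x , y))
      (cong₂ _,_ (trans x≡ky (cong (k *_) y≡n)) y≡n , ≤-reflexive x≡ky ∷ [])
    where
    x≡ky = trans (sym (+-identityʳ x)) height
    y≡n  = trans (sym (+-identityʳ y)) ups
  numberOf-excursions zero x y (suc h) zero height ups size
    with () ← trans size (size-right k 0 h)
  numberOf-excursions zero x y h (suc u) height ups size
    with () ← trans size (+-suc (k * suc u + h) u)
  numberOf-excursions (suc ℓ) x y zero zero height ups size
    with () ← trans size (cong (λ m → m + 0 + 0) (*-zeroʳ k))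
  numberOf-excursions (suc ℓ) x y (suc h) zero height ups size = begin
    numberOf (excursion? (x , y)) (suc ℓ)
      ≡⟨ excursions-suc ℓ x y (subst (x ≤_) height (m≤m+n x (suc h))) ⟩
    numberOf (excursion? (suc x , y)) ℓ + numberOf (excursion? (x , suc y)) ℓ
      ≡⟨ cong₂ _+_
           (numberOf-excursions ℓ (suc x) y h zero (trans (sym (+-suc x h)) height) ups
             (suc-injective (trans size (size-right k 0 h))))
           (overshoot ℓ x (suc y) (≤-reflexive (cong suc (trans (sym ups) (+-identityʳ y))))) ⟩
    1 ∎
    where open ≡-Reasoning
  numberOf-excursions (suc ℓ) x y zero (suc u) height ups size = begin
    numberOf (excursion? (x , y)) (suc ℓ)
      ≡⟨ excursions-suc ℓ x y (≤-reflexive x≡ky) ⟩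
    numberOf (excursion? (suc x , y)) ℓ + numberOf (excursion? (x , suc y)) ℓ
      -- From height 0 a right step leaves the region, which matches `firstPassage k (suc u) 0 = 0`.
      ≡⟨ cong₂ _+_ (below ℓ (suc x) y (≤-reflexive (cong suc (sym x≡ky))))
                   (excursions-up ℓ x y zero u height ups size) ⟩
    firstPassage k u (suc (k + 0)) ∎
    where
    open ≡-Reasoning
    x≡ky = trans (sym (+-identityʳ x)) height
  numberOf-excursions (suc ℓ) x y (suc h) (suc u) height ups size = begin
    numberOf (excursion? (x , y)) (suc ℓ)
      ≡⟨ excursions-suc ℓ x y (subst (x ≤_) height (m≤m+n x (suc h))) ⟩
    numberOf (excursion? (suc x , y)) ℓ + numberOf (excursion? (x , suc y)) ℓ
      ≡⟨ cong₂ _+_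
           (numberOf-excursions ℓ (suc x) y h (suc u) (trans (sym (+-suc x h)) height) ups
             (suc-injective (trans size (size-right k (suc u) h))))
           (excursions-up ℓ x y (suc h) u height ups size) ⟩
    firstPassage k (suc u) (suc h) + firstPassage k u (suc (k + suc h)) ∎
    where open ≡-Reasoning

e≡firstPassage : ∀ k n → e k n ≡ firstPassage k n 1
e≡firstPassage k n = trans
  (numberOf-≐ (isExcursion? k n) (excursion? k n origin) ((λ p → p) , (λ p → p)) (k * n + n))
  (numberOf-excursions k n (k * n + n) 0 0 0 n (sym (*-zeroʳ k)) refl
    (cong (_+ n) (sym (+-identityʳ (k * n)))))

-- Binomial identities

-- With `N = d + n` this is the classical ratio of neighbouring binomials, the factor `N - n` being
-- written as `d`.
[1+n]*C[d+n,1+n]≡d*C[d+n,n] : ∀ d n → suc n * ((d + n) C suc n) ≡ d * ((d + n) C n)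
[1+n]*C[d+n,1+n]≡d*C[d+n,n] zero n =
  trans (cong (suc n *_) (k>n⇒nCk≡0 (n<1+n n))) (*-zeroʳ (suc n))
[1+n]*C[d+n,1+n]≡d*C[d+n,n] (suc d) n = begin
  suc n * (suc (d + n) C suc n)
    ≡⟨ cong (suc n *_) (nCk+nC[k+1]≡[n+1]C[k+1] (d + n) n) ⟨
  suc n * (c + (d + n) C suc n)
    ≡⟨ *-distribˡ-+ (suc n) c _ ⟩
  suc n * c + suc n * ((d + n) C suc n)
    ≡⟨ cong (suc n * c +_) ([1+n]*C[d+n,1+n]≡d*C[d+n,n] d n) ⟩
  suc n * c + d * c
    ≡⟨ lower n ⟩
  suc d * (suc (d + n) C n) ∎
  where
  open ≡-Reasoning
  c = (d + n) C n
  -- With `N = d + n` this reads `(N + 1) C(N, n) = (N + 1 - n) C(N + 1, n)`. Its successor case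
  -- calls the outer lemma again at `suc d`, but with a smaller `n`.
  lower : ∀ n → suc n * ((d + n) C n) + d * ((d + n) C n) ≡ suc d * (suc (d + n) C n)
  lower zero = unit d
    where
    unit : ∀ d → 1 + d * 1 ≡ suc d * 1
    unit = solve-∀
  lower (suc n) = begin
    suc (suc n) * c′ + d * c′
      ≡⟨ regroup n d c′ ⟩
    suc n * c′ + suc d * c′
      ≡⟨ cong (_+ suc d * c′) (subst (λ N → suc n * (N C suc n) ≡ suc d * (N C n)) (sym (+-suc d n))
           ([1+n]*C[d+n,1+n]≡d*C[d+n,n] (suc d) n)) ⟩
    suc d * ((d + suc n) C n) + suc d * c′
      ≡⟨ *-distribˡ-+ (suc d) _ c′ ⟨
    suc d * ((d + suc n) C n + c′)
      ≡⟨ cong (suc d *_) (nCk+nC[k+1]≡[n+1]C[k+1] (d + suc n) n) ⟩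
    suc d * (suc (d + suc n) C suc n) ∎
    where
    c′ = (d + suc n) C suc n
    regroup : ∀ n d c → suc (suc n) * c + d * c ≡ suc n * c + suc d * c
    regroup = solve-∀

-- The preceding ratio at `d = k * suc n`, where the factor `suc n` cancels. It serves as the
-- boundary case at height 0 of the ballot identity.
C[k[1+n]+n,1+n]≡k*C[k[1+n]+n,n] : ∀ k n →
  (k * suc n + n) C suc n ≡ k * ((k * suc n + n) C n)
C[k[1+n]+n,1+n]≡k*C[k[1+n]+n,n] k n = *-cancelˡ-≡ _ _ (suc n) (begin
  suc n * ((k * suc n + n) C suc n)  ≡⟨ [1+n]*C[d+n,1+n]≡d*C[d+n,n] (k * suc n) n ⟩
  k * suc n * c                      ≡⟨ regroup k n c ⟩
  suc n * (k * c)                    ∎)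
  where
  open ≡-Reasoning
  c = (k * suc n + n) C n
  regroup : ∀ k n c → k * suc n * c ≡ suc n * (k * c)
  regroup = solve-∀

-- `suc M C n` and `M C n` count the unrestricted paths to height 0 with `n` up steps, from heights
-- `h + 1` and `h`. All terms obey the same first-step recursion, so only the cases without up steps
-- and at height 0 need a separate check.
ballot : ∀ k n h M → M ≡ k * n + n + h →
  firstPassage k n (suc h) + k * (suc M C n) ≡ suc k * (M C n)
-- The same identity with at least one up step and starting height `h`, so that the induction can
-- descend to height 0.
ballot′ : ∀ k n h M → M ≡ k * suc n + n + h →
  firstPassage k (suc n) h + k * (suc M C suc n) ≡ suc k * (M C suc n)

ballot k zero    h M M≡ = unit k
  where
  unit : ∀ k → 1 + k * 1 ≡ suc k * 1
  unit = solve-∀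
ballot k (suc n) h M M≡ = ballot′ k n (suc h) M (trans M≡ (reindex k n h))
  where
  reindex : ∀ k n h → k * suc n + suc n + h ≡ k * suc n + n + suc h
  reindex = solve-∀

ballot′ k n zero M M≡ = begin
  k * (suc M C suc n)        ≡⟨ cong (k *_) (nCk+nC[k+1]≡[n+1]C[k+1] M n) ⟨
  k * (M C n + M C suc n)    ≡⟨ *-distribˡ-+ k (M C n) (M C suc n) ⟩
  k * (M C n) + k * (M C suc n)
    ≡⟨ cong (_+ k * (M C suc n)) base ⟨
  suc k * (M C suc n)        ∎
  where
  open ≡-Reasoning
  -- At height 0 the first-passage term vanishes, and Pascal's rule reduces the claim to this
  -- proportion.
  base : M C suc n ≡ k * (M C n)
  base = subst (λ N → N C suc n ≡ k * (N C n)) (sym (trans M≡ (+-identityʳ (k * suc n + n))))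
    (C[k[1+n]+n,1+n]≡k*C[k[1+n]+n,n] k n)
ballot′ k n (suc h) zero M≡ with () ← trans M≡ (+-suc (k * suc n + n) h)
ballot′ k n (suc h) (suc M) M≡ = begin
  (f + g) + k * (suc (suc M) C suc n)
    ≡⟨ cong (λ m → (f + g) + k * m) (nCk+nC[k+1]≡[n+1]C[k+1] (suc M) n) ⟨
  (f + g) + k * (suc M C n + suc M C suc n)
    ≡⟨ regroup f g k (suc M C n) (suc M C suc n) ⟩
  (g + k * (suc M C n)) + (f + k * (suc M C suc n))
    -- The up step leads to height `k + h + 1` with `n` up steps left, the right step to height `h`;
    -- both use the same `M`.
    ≡⟨ cong₂ _+_ (ballot k n (k + h) M (trans M≡′ (reindex k n h))) (ballot′ k n h M M≡′) ⟩
  suc k * (M C n) + suc k * (M C suc n)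
    ≡⟨ *-distribˡ-+ (suc k) (M C n) (M C suc n) ⟨
  suc k * (M C n + M C suc n)
    ≡⟨ cong (suc k *_) (nCk+nC[k+1]≡[n+1]C[k+1] M n) ⟩
  suc k * (suc M C suc n) ∎
  where
  open ≡-Reasoning
  f = firstPassage k (suc n) h
  g = firstPassage k n (suc (k + h))
  M≡′ : M ≡ k * suc n + n + h
  M≡′ = suc-injective (trans M≡ (+-suc (k * suc n + n) h))
  regroup : ∀ f g k p q → (f + g) + k * (p + q) ≡ (g + k * p) + (f + k * q)
  regroup = solve-∀
  reindex : ∀ k n h → k * suc n + n + h ≡ k * n + n + (k + h)
  reindex = solve-∀

-- Power series

infixl 6 _⊕_

_⊕_ : Series → Series → Series
(F ⊕ G) n = F n ℚ.+ G n

⊛-congʳ : ∀ F {G H} → G ≗ H → F ⊛ G ≗ F ⊛ H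
⊛-congʳ F G≗H zero    = cong (F 0 ℚ.*_) (G≗H 0)
⊛-congʳ F G≗H (suc n) = cong₂ ℚ._+_ (cong (F 0 ℚ.*_) (G≗H (suc n))) (⊛-congʳ (tail F) G≗H n)

-- The product is defined by peeling its left factor. Peeling the right one instead exposes the
-- recursion of `firstPassage` when that factor is `FirstPassage k j`.
⊛-suc : ∀ F G n → (F ⊛ G) (suc n) ≡ F (suc n) ℚ.* G 0 ℚ.+ (F ⊛ tail G) n
⊛-suc F G zero    = ℚ.+-comm (F 0 ℚ.* G 1) (F 1 ℚ.* G 0)
⊛-suc F G (suc n) = trans (cong (p ℚ.+_) (⊛-suc (tail F) G n))
  (lemma p (F (suc (suc n)) ℚ.* G 0) ((tail F ⊛ tail G) n))
  where
  p = F 0 ℚ.* G (suc (suc n))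
  lemma : ∀ p q r → p ℚ.+ (q ℚ.+ r) ≡ q ℚ.+ (p ℚ.+ r)
  lemma = +-*-Solver.solve 3 (λ p q r → p :+ (q :+ r) := q :+ (p :+ r)) refl
    where open +-*-Solver

⊛-distribˡ-⊕ : ∀ F G H → F ⊛ (G ⊕ H) ≗ F ⊛ G ⊕ F ⊛ H
⊛-distribˡ-⊕ F G H zero    = ℚ.*-distribˡ-+ (F 0) (G 0) (H 0)
⊛-distribˡ-⊕ F G H (suc n) =
  trans (cong (F 0 ℚ.* (G (suc n) ℚ.+ H (suc n)) ℚ.+_) (⊛-distribˡ-⊕ (tail F) G H n))
    (lemma (F 0) (G (suc n)) (H (suc n)) _ _)
  where
  lemma : ∀ f g h p q → f ℚ.* (g ℚ.+ h) ℚ.+ (p ℚ.+ q) ≡ f ℚ.* g ℚ.+ p ℚ.+ (f ℚ.* h ℚ.+ q)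
  lemma = +-*-Solver.solve 5
    (λ f g h p q → f :* (g :+ h) :+ (p :+ q) := f :* g :+ p :+ (f :* h :+ q)) refl
    where open +-*-Solver

⊛-⊖-· : ∀ F G c H → F ⊛ (G ⊖ c · H) ≗ F ⊛ G ⊖ c · (F ⊛ H)
⊛-⊖-· F G c H zero = lemma (F 0) (G 0) c (H 0)
  where
  lemma : ∀ f g c h → f ℚ.* (g ℚ.- c ℚ.* h) ≡ f ℚ.* g ℚ.- c ℚ.* (f ℚ.* h)
  lemma = +-*-Solver.solve 4 (λ f g c h → f :* (g :- c :* h) := f :* g :- c :* (f :* h)) refl
    where open +-*-Solver
⊛-⊖-· F G c H (suc n) =
  trans (cong (F 0 ℚ.* (G (suc n) ℚ.- c ℚ.* H (suc n)) ℚ.+_) (⊛-⊖-· (tail F) G c H n))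
    (lemma (F 0) (G (suc n)) c (H (suc n)) _ _)
  where
  lemma : ∀ f g c h p q → f ℚ.* (g ℚ.- c ℚ.* h) ℚ.+ (p ℚ.- c ℚ.* q)
    ≡ f ℚ.* g ℚ.+ p ℚ.- c ℚ.* (f ℚ.* h ℚ.+ q)
  lemma = +-*-Solver.solve 6 (λ f g c h p q →
    f :* (g :- c :* h) :+ (p :- c :* q) := f :* g :+ p :- c :* (f :* h :+ q)) refl
    where open +-*-Solver

⊛-zeroʳ : ∀ F → F ⊛ (λ _ → 0ℚ) ≗ (λ _ → 0ℚ)
⊛-zeroʳ F zero    = ℚ.*-zeroʳ (F 0)
⊛-zeroʳ F (suc n) = cong₂ ℚ._+_ (ℚ.*-zeroʳ (F 0)) (⊛-zeroʳ (tail F) n)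

⊛-const : ∀ F c → F ⊛ const c ≗ c · F
⊛-const F c zero    = ℚ.*-comm (F 0) c
⊛-const F c (suc n) = trans (cong₂ ℚ._+_ (ℚ.*-zeroʳ (F 0)) (⊛-const (tail F) c n))
  (ℚ.+-identityˡ (c ℚ.* F (suc n)))

-- Invertibility of `G 0` forces `X 0` to be the leading quotient; then `tail X` solves the same
-- problem for the next remainder of the long division.
⊘-unique : ∀ X F G .{{_ : ℚ.NonZero (G 0)}} → X ⊛ G ≗ F → X ≗ F ⊘ G
⊘-unique X F G XG≗F zero = begin
  X 0                      ≡⟨ ℚ.*-identityʳ (X 0) ⟨
  X 0 ℚ.* 1ℚ               ≡⟨ cong (X 0 ℚ.*_) (ℚ.*-inverseʳ (G 0)) ⟨
  X 0 ℚ.* (G 0 ℚ.* ℚ.1/ G 0)  ≡⟨ ℚ.*-assoc (X 0) (G 0) (ℚ.1/ G 0) ⟨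
  X 0 ℚ.* G 0 ℚ.* ℚ.1/ G 0    ≡⟨ cong (ℚ._* ℚ.1/ G 0) (XG≗F 0) ⟩
  F 0 ℚ.÷ G 0              ∎
  where open ≡-Reasoning
⊘-unique X F G XG≗F (suc n) =
  ⊘-unique (tail X) (tail F ⊖ (F 0 ℚ.÷ G 0) · tail G) G tail-eq n
  where
  open ≡-Reasoning
  lemma : ∀ p q → q ≡ p ℚ.+ q ℚ.- p
  lemma = +-*-Solver.solve 2 (λ p q → q := p :+ q :- p) refl
    where open +-*-Solver
  tail-eq : tail X ⊛ G ≗ tail F ⊖ (F 0 ℚ.÷ G 0) · tail G
  tail-eq m = begin
    (tail X ⊛ G) m
      ≡⟨ lemma (X 0 ℚ.* G (suc m)) ((tail X ⊛ G) m) ⟩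
    (X ⊛ G) (suc m) ℚ.- X 0 ℚ.* G (suc m)
      ≡⟨ cong₂ (λ f c → f ℚ.- c ℚ.* G (suc m)) (XG≗F (suc m)) (⊘-unique X F G XG≗F 0) ⟩
    F (suc m) ℚ.- (F 0 ℚ.÷ G 0) ℚ.* G (suc m) ∎

fromℕ-* : ∀ m n → fromℕ (m * n) ≡ fromℕ m ℚ.* fromℕ n
fromℕ-* zero    n = sym (ℚ.*-zeroˡ (fromℕ n))
fromℕ-* (suc m) n = begin
  fromℕ (n + m * n)                     ≡⟨ fromℕ-+ n (m * n) ⟩
  fromℕ n ℚ.+ fromℕ (m * n)             ≡⟨ cong (fromℕ n ℚ.+_) (fromℕ-* m n) ⟩
  fromℕ n ℚ.+ fromℕ m ℚ.* fromℕ n       ≡⟨ lemma (fromℕ n) (fromℕ m) ⟩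
  (1ℚ ℚ.+ fromℕ m) ℚ.* fromℕ n          ≡⟨ cong (ℚ._* fromℕ n) (fromℕ-+ 1 m) ⟨
  fromℕ (suc m) ℚ.* fromℕ n             ∎
  where
  open ≡-Reasoning
  lemma : ∀ p q → p ℚ.+ q ℚ.* p ≡ (1ℚ ℚ.+ q) ℚ.* p
  lemma = +-*-Solver.solve 2 (λ p q → p :+ q :* p := (con 1ℚ :+ q) :* p) refl
    where open +-*-Solver

-- Generating functions of bridges and first passages

FirstPassage : ℕ → ℕ → Series
FirstPassage k j n = fromℕ (firstPassage k n j)

-- Every path from height j to height 0 is a first passage to 0 followed by a bridge.
B⊛FirstPassage : ∀ k j n → (B k ⊛ FirstPassage k j) n ≡ fromℕ ((k * n + n + j) C n)
B⊛FirstPassage k j zero = cong (λ m → fromℕ m ℚ.* 1ℚ) (b≡C k 0)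
B⊛FirstPassage k zero (suc n) = begin
  -- A first passage from height 0 is empty, so the right factor is the series 1.
  (B k ⊛ FirstPassage k 0) (suc n)
    ≡⟨ ⊛-suc (B k) (FirstPassage k 0) n ⟩
  B k (suc n) ℚ.* 1ℚ ℚ.+ (B k ⊛ (λ _ → 0ℚ)) n
    ≡⟨ cong₂ ℚ._+_ (ℚ.*-identityʳ (B k (suc n))) (⊛-zeroʳ (B k) n) ⟩
  B k (suc n) ℚ.+ 0ℚ
    ≡⟨ ℚ.+-identityʳ (B k (suc n)) ⟩
  B k (suc n)
    ≡⟨ cong fromℕ (b≡C k (suc n)) ⟩
  fromℕ ((k * suc n + suc n) C suc n)
    ≡⟨ cong (λ N → fromℕ (N C suc n)) (+-identityʳ (k * suc n + suc n)) ⟨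
  fromℕ ((k * suc n + suc n + 0) C suc n) ∎
  where open ≡-Reasoning
B⊛FirstPassage k (suc j) (suc n) = begin
  (B k ⊛ FirstPassage k (suc j)) (suc n)
    ≡⟨ ⊛-suc (B k) (FirstPassage k (suc j)) n ⟩
  B k (suc n) ℚ.* 1ℚ ℚ.+ (B k ⊛ tail (FirstPassage k (suc j))) n
    -- The right-step part regains the constant coefficient, 1 at every height, and becomes the full
    -- product at height `j`; the up-step part is the product at height `k + j + 1` with one up step
    -- fewer. The resulting binomials share their upper index, and Pascal's rule adds them.
    ≡⟨ cong (B k (suc n) ℚ.* 1ℚ ℚ.+_) (trans
         (⊛-congʳ (B k) (λ m → fromℕ-+ (firstPassage k (suc m) j) _) n)
         (⊛-distribˡ-⊕ (B k) (tail (FirstPassage k j)) (FirstPassage k (suc (k + j))) n)) ⟩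
  B k (suc n) ℚ.* 1ℚ ℚ.+ ((B k ⊛ tail (FirstPassage k j)) n ℚ.+ q)
    ≡⟨ ℚ.+-assoc (B k (suc n) ℚ.* 1ℚ) _ q ⟨
  B k (suc n) ℚ.* 1ℚ ℚ.+ (B k ⊛ tail (FirstPassage k j)) n ℚ.+ q
    ≡⟨ cong (ℚ._+ q) (⊛-suc (B k) (FirstPassage k j) n) ⟨
  (B k ⊛ FirstPassage k j) (suc n) ℚ.+ q
    ≡⟨ cong₂ ℚ._+_ (B⊛FirstPassage k j (suc n)) (B⊛FirstPassage k (suc (k + j)) n) ⟩
  fromℕ (M C suc n) ℚ.+ fromℕ ((k * n + n + suc (k + j)) C n)
    ≡⟨ fromℕ-+ (M C suc n) _ ⟨
  fromℕ (M C suc n + (k * n + n + suc (k + j)) C n)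
    ≡⟨ cong (λ N → fromℕ (M C suc n + N C n)) (reindex k n j) ⟩
  fromℕ (M C suc n + M C n)
    ≡⟨ cong fromℕ (trans (+-comm (M C suc n) (M C n)) (nCk+nC[k+1]≡[n+1]C[k+1] M n)) ⟩
  fromℕ (suc M C suc n)
    ≡⟨ cong (λ N → fromℕ (N C suc n)) (+-suc (k * suc n + suc n) j) ⟨
  fromℕ ((k * suc n + suc n + suc j) C suc n) ∎
  where
  open ≡-Reasoning
  M = k * suc n + suc n + j
  q = (B k ⊛ FirstPassage k (suc (k + j))) n
  reindex : ∀ k n j → k * n + n + suc (k + j) ≡ k * suc n + suc n + j
  reindex = solve-∀

B⊛E : ∀ k n → (B k ⊛ E k) n ≡ fromℕ ((k * n + n + 1) C n)
B⊛E k n = trans (⊛-congʳ (B k) (λ m → cong fromℕ (e≡firstPassage k m)) n) (B⊛FirstPassage k 1 n)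

e+k*C≡[k+1]*b : ∀ k n → e k n + k * ((k * n + n + 1) C n) ≡ (k + 1) * b k n
e+k*C≡[k+1]*b k n = begin
  e k n + k * ((k * n + n + 1) C n)
    ≡⟨ cong (_+ k * ((k * n + n + 1) C n)) (e≡firstPassage k n) ⟩
  firstPassage k n 1 + k * ((k * n + n + 1) C n)
    ≡⟨ cong (λ N → firstPassage k n 1 + k * (N C n)) (+-comm (k * n + n) 1) ⟩
  firstPassage k n 1 + k * (suc (k * n + n) C n)
    ≡⟨ ballot k n 0 (k * n + n) (sym (+-identityʳ (k * n + n))) ⟩
  suc k * ((k * n + n) C n)
    ≡⟨ cong (_* ((k * n + n) C n)) (+-comm 1 k) ⟩
  (k + 1) * ((k * n + n) C n)
    ≡⟨ cong ((k + 1) *_) (b≡C k n) ⟨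
  (k + 1) * b k n ∎
  where open ≡-Reasoning

B⊛denominator : ∀ k → B k ⊛ denominator k ≗ E k
B⊛denominator k n = begin
  (B k ⊛ denominator k) n
    ≡⟨ ⊛-⊖-· (B k) (const (fromℕ (k + 1))) (fromℕ k) (E k) n ⟩
  (B k ⊛ const (fromℕ (k + 1))) n ℚ.- fromℕ k ℚ.* (B k ⊛ E k) n
    ≡⟨ cong₂ (λ p q → p ℚ.- fromℕ k ℚ.* q) (⊛-const (B k) (fromℕ (k + 1)) n) (B⊛E k n) ⟩
  fromℕ (k + 1) ℚ.* B k n ℚ.- fromℕ k ℚ.* fromℕ c
    ≡⟨ cong₂ ℚ._-_ (fromℕ-* (k + 1) (b k n)) (fromℕ-* k c) ⟨
  fromℕ ((k + 1) * b k n) ℚ.- fromℕ (k * c)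
    -- The ballot identity is additive in ℕ; the subtraction takes place only on its image in ℚ.
    ≡⟨ cong (λ m → fromℕ m ℚ.- fromℕ (k * c)) (e+k*C≡[k+1]*b k n) ⟨
  fromℕ (e k n + k * c) ℚ.- fromℕ (k * c)
    ≡⟨ cong (ℚ._- fromℕ (k * c)) (fromℕ-+ (e k n) (k * c)) ⟩
  fromℕ (e k n) ℚ.+ fromℕ (k * c) ℚ.- fromℕ (k * c)
    ≡⟨ lemma (fromℕ (e k n)) (fromℕ (k * c)) ⟩
  fromℕ (e k n) ∎
  where
  open ≡-Reasoning
  c = (k * n + n + 1) C n
  lemma : ∀ p q → p ℚ.+ q ℚ.- q ≡ p
  lemma = +-*-Solver.solve 2 (λ p q → p :+ q :- q := p) refl
    where open +-*-Solver

corollary13 : (k : ℕ) .{{_ : NonZero k}} →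
    let instance _ = denominator-nonZero k in
    B k ≗ E k ⊘ (const (fromℕ (k + 1)) ⊖ fromℕ k · E k)
corollary13 k = ⊘-unique (B k) (E k) (denominator k) {{denominator-nonZero k}} (B⊛denominator k)
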